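{- Let $p>0$ be an integer, and let $T^p(n,k)$ ($n\ge 0$, $0\le k\le n$) be the integers defined in the context. Then the integers $T^p(n,k)$ can equivalently be defined, for $n\ge 0$ and $1-p\le k\le n$, by the initial conditions $$T^p(0,0)=1,\qquad T^p(n,n)=0\ \text{ for } n>0,\qquad T^p(n,-j)=0\ \text{ for } n\ge 0,\ j=1,\dots,p-1,$$ together with the recurrence, for $n>0$ and $0\le k<n$, $$T^p(n,k)=T^p(n-1,k)+\sum_{j=1}^{p-1}(-1)^{j-1}\binom{p-1}{j}\,T^p(n,k-j).$$ That is, the unique array indexed by $n\ge 0$, $1-p\le k\le n$ that satisfies these initial conditions and this recurrence agrees with the array $T^p(n,k)$ of the context for all $n\ge 0$, $0\le k\le n$.
   Context: For every integer $p>0$, the integers $T^p(n,k)$, for $n\ge 0$ and $0\le k\le n$, are defined by the initial conditions $T^p(0,0)=1$ and $T^p(n,n)=0$ for $n>0$, and by the recurrence, for $n>0$ and $0\le k<n$, $$T^p(n,k)=\sum_{j=0}^{k}\binom{k-j+p-2}{p-2}\,T^p(n-1,j).$$ Convention for $p=1$: $\binom{m-1}{ -1}$ is understood to be $1$ if $m=0$ and $0$ if $m>0$, so that the recurrence reads $T^1(n,k)=T^1(n-1,k)$, giving $T^1(n,0)=1$ for $n>0$ and $T^1(n,k)=0$ for $k>0$. -}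

module Defs where

open import Data.Bool.Base using (if_then_else_)
open import Data.Fin.Base using (toℕ)
open import Data.Integer.Base as ℤ using (ℤ; +_; -_; 0ℤ; 1ℤ; -1ℤ)
open import Data.Integer.Properties using (+-0-monoid)
open import Data.Nat.Base using (ℕ; zero; suc; _+_; _∸_; _≤_; _<_; NonZero)
open import Data.Nat.Combinatorics using (_C_)
open import Data.Nat.Properties using (_<?_; n≮n)
open import Relation.Binary.PropositionalEquality using (_≡_; refl)
open import Relation.Nullary.Decidable using (does; dec-true; dec-false)

open import Algebra.Properties.Monoid.Sum +-0-monoid using (sum-syntax; sum⁺-syntax)

-- The binomial coefficient (m + p - 2 choose p - 2); for p = 1 it is
-- (m - 1 choose -1), understood to be 1 if m = 0 and 0 if m > 0.
coefficient : (p : ℕ) → .{{NonZero p}} → ℕ → ℕ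
coefficient (suc zero)    zero    = 1
coefficient (suc zero)    (suc _) = 0
coefficient (suc (suc q)) m       = (m + q) C q

-- Only the entries T p n k with k ≤ n are meaningful; the others are set to 0.
T : (p : ℕ) → .{{NonZero p}} → ℕ → ℕ → ℤ
T p zero    zero    = 1ℤ
T p zero    (suc _) = 0ℤ
T p (suc n) k       =
  if does (k <? suc n)
  then (∑[ j ≤ k ] (+ coefficient p (k ∸ toℕ j) ℤ.* T p n (toℕ j)))
  else 0ℤ

T-origin : ∀ p .{{_ : NonZero p}} → T p 0 0 ≡ 1ℤ
T-origin p = refl

T-diagonal : ∀ p .{{_ : NonZero p}} n → T p (suc n) (suc n) ≡ 0ℤ
T-diagonal p n rewrite dec-false (suc n <? suc n) (n≮n (suc n)) = refl

T-recurrence : ∀ p .{{_ : NonZero p}} n k → k < suc n →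
  T p (suc n) k ≡ ∑[ j ≤ k ] (+ coefficient p (k ∸ toℕ j) ℤ.* T p n (toℕ j))
T-recurrence p n k k<1+n rewrite dec-true (k <? suc n) k<1+n = refl

-- An array indexed by n ≥ 0 and 1 - p ≤ k ≤ n is represented by a total
-- function.  The conditions below mention only entries with indices in this
-- domain, and two arrays are identified when they agree on it.
Array : Set
Array = ℕ → ℤ → ℤ

_≈[_]_ : Array → ℕ → Array → Set
U ≈[ p ] V = ∀ n k → 1ℤ ℤ.- + p ℤ.≤ k → k ℤ.≤ + n → U n k ≡ V n k

record IsExtendedArray (p : ℕ) (U : Array) : Set where
  field
    origin     : U 0 0ℤ ≡ 1ℤ
    diagonal   : ∀ n → 0 < n → U n (+ n) ≡ 0ℤ
    negative   : ∀ n j → 1 ≤ j → j ≤ p ∸ 1 → U n (- + j) ≡ 0ℤ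
    -- The summation index j runs from 1 to p - 1.
    recurrence : ∀ n k → k < suc n →
      U (suc n) (+ k) ≡
        U n (+ k) ℤ.+
        (∑[ i < p ∸ 1 ] (let j = suc (toℕ i) in
          -1ℤ ℤ.^ (j ∸ 1) ℤ.* + ((p ∸ 1) C j) ℤ.* U (suc n) (+ k ℤ.- + j)))

{-# OPTIONS --safe #-}

-- In terms of the row generating functions, truncated below degree n, the
-- recurrence of the context reads Tₙ(x) = (1 - x)^(1-p) Tₙ₋₁(x), and the
-- extended recurrence reads (1 - x)^(p-1) Tₙ(x) = Tₙ₋₁(x).  The passage from
-- one to the other uses that backward differencing lowers the order of the
-- convolution by one and that the signed binomial sum iterates backward
-- differencing.

module Submission where

open import Defs
open import Data.Fin.Base using (Fin; toℕ; fromℕ; inject₁)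
open import Data.Fin.Properties using (toℕ-fromℕ; toℕ-inject₁; toℕ<n; toℕ≤pred[n])
open import Data.Integer.Base as ℤ using (ℤ; +_; -_; -[1+_]; 0ℤ; 1ℤ; -1ℤ)
open import Data.Integer.Properties as ℤₚ
  using (+-0-monoid; +-0-commutativeMonoid; +-*-semiring)
open import Data.Integer.Tactic.RingSolver using (solve-∀)
open import Data.Nat.Base
  using (ℕ; zero; suc; _+_; _∸_; _≤_; _<_; z≤n; s≤s; z<s; NonZero)
open import Data.Nat.Combinatorics
  using (_C_; nCn≡1; k>n⇒nCk≡0; nCk+nC[k+1]≡[n+1]C[k+1])
open import Data.Nat.Induction using (<-rec)
open import Data.Nat.Properties
  using (_≤?_; +-comm; +-suc; +-∸-assoc; n∸n≡0; m∸n≤m; m<n⇒0<n∸m; n<1+n;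
         ≤-trans; ≰⇒>; m≤n⇒m<n∨m≡n; ∸-monoʳ-<)
open import Data.Product.Base using (_×_; _,_; ∃-syntax)
open import Data.Sum.Base using (inj₁; inj₂)
open import Function.Base using (_∘_)
open import Relation.Binary.PropositionalEquality
  using (_≡_; _≗_; refl; sym; trans; cong; cong₂; module ≡-Reasoning)
open import Relation.Nullary.Decidable using (yes; no)

open import Algebra.Properties.Monoid.Sum +-0-monoid
  using (sum-syntax; sum⁺-syntax; sum-cong-≗; sum-init-last)
open import Algebra.Properties.CommutativeMonoid.Sum +-0-commutativeMonoid using (∑-distrib-+)
open import Algebra.Properties.Semiring.Sum +-*-semiring using (*-distribˡ-sum)

open ≡-Reasoning

-- Pascal's rule for the coefficients and their convolutions

coefficient-zero : ∀ r → coefficient (suc r) 0 ≡ 1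
coefficient-zero zero    = refl
coefficient-zero (suc q) = nCn≡1 q

coefficient-pascal : ∀ r m →
  coefficient (suc (suc r)) (suc m) ≡
  coefficient (suc (suc r)) m + coefficient (suc r) (suc m)
coefficient-pascal zero    m = refl
coefficient-pascal (suc q) m = begin
  suc (m + suc q) C suc q                    ≡⟨ nCk+nC[k+1]≡[n+1]C[k+1] (m + suc q) q ⟨
  (m + suc q) C q + (m + suc q) C suc q      ≡⟨ +-comm ((m + suc q) C q) _ ⟩
  (m + suc q) C suc q + (m + suc q) C q      ≡⟨ cong (λ n → (m + suc q) C suc q + n C q) (+-suc m q) ⟩
  (m + suc q) C suc q + (suc m + q) C q      ∎

-- Multiplication of the generating function of `a` by (1 - x)^(-r), where `r` stands for p - 1.
convolution : ℕ → (ℕ → ℤ) → ℕ → ℤ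
convolution r a k = ∑[ j ≤ k ] (+ coefficient (suc r) (k ∸ toℕ j) ℤ.* a (toℕ j))

-- The last coefficient is 1; pulling `suc` out of the subtraction brings the others into the form
-- to which Pascal's rule applies.
convolution-suc : ∀ r a k →
  convolution r a (suc k) ≡
  (∑[ j ≤ k ] (+ coefficient (suc r) (suc (k ∸ toℕ j)) ℤ.* a (toℕ j))) ℤ.+ a (suc k)
convolution-suc r a k =
  trans (sum-init-last term) (cong₂ ℤ._+_ (sum-cong-≗ inner) outer)
  where
  term : Fin (suc (suc k)) → ℤ
  term = λ j → + coefficient (suc r) (suc k ∸ toℕ j) ℤ.* a (toℕ j)

  inner : (j : Fin (suc k)) →
    term (inject₁ j) ≡ + coefficient (suc r) (suc (k ∸ toℕ j)) ℤ.* a (toℕ j)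
  inner j rewrite toℕ-inject₁ j | +-∸-assoc 1 (toℕ≤pred[n] j) = refl

  outer : term (fromℕ (suc k)) ≡ a (suc k)
  outer rewrite toℕ-fromℕ k | n∸n≡0 k | coefficient-zero r = ℤₚ.*-identityˡ _

convolution-origin : ∀ r a → convolution r a 0 ≡ a 0
convolution-origin r a rewrite coefficient-zero r =
  trans (ℤₚ.+-identityʳ _) (ℤₚ.*-identityˡ _)

convolution-order0 : ∀ a → convolution 0 a ≗ a
convolution-order0 a zero    = convolution-origin 0 a
convolution-order0 a (suc k) = begin
  convolution 0 a (suc k)                       ≡⟨ convolution-suc 0 a k ⟩
  (∑[ j ≤ k ] (0ℤ ℤ.* a (toℕ j))) ℤ.+ a (suc k)
    ≡⟨ cong (ℤ._+ a (suc k)) (*-distribˡ-sum 0ℤ (λ (j : Fin (suc k)) → a (toℕ j))) ⟨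
  0ℤ ℤ.* (∑[ j ≤ k ] a (toℕ j)) ℤ.+ a (suc k)   ≡⟨ ℤₚ.+-identityˡ _ ⟩
  a (suc k)                                     ∎

-- Pascal's rule splits every coefficient but the last. The `low` parts form the convolution one
-- place earlier; the `high` parts and the last term form the one of lower order.
convolution-pascal : ∀ r a k →
  convolution (suc r) a (suc k) ≡ convolution (suc r) a k ℤ.+ convolution r a (suc k)
convolution-pascal r a k = begin
  convolution (suc r) a (suc k)
    ≡⟨ convolution-suc (suc r) a k ⟩
  (∑[ j ≤ k ] (+ coefficient (suc (suc r)) (suc (k ∸ toℕ j)) ℤ.* a (toℕ j))) ℤ.+ a (suc k)
    ≡⟨ cong (ℤ._+ a (suc k)) (sum-cong-≗ termwise) ⟩
  (∑[ j ≤ k ] (low j ℤ.+ high j)) ℤ.+ a (suc k)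
    ≡⟨ cong (ℤ._+ a (suc k)) (∑-distrib-+ low high) ⟩
  (convolution (suc r) a k ℤ.+ (∑[ j ≤ k ] high j)) ℤ.+ a (suc k)
    ≡⟨ ℤₚ.+-assoc (convolution (suc r) a k) _ _ ⟩
  convolution (suc r) a k ℤ.+ ((∑[ j ≤ k ] high j) ℤ.+ a (suc k))
    ≡⟨ cong (λ x → convolution (suc r) a k ℤ.+ x) (convolution-suc r a k) ⟨
  convolution (suc r) a k ℤ.+ convolution r a (suc k)
    ∎
  where
  low high : Fin (suc k) → ℤ
  low  j = + coefficient (suc (suc r)) (k ∸ toℕ j) ℤ.* a (toℕ j)
  high j = + coefficient (suc r) (suc (k ∸ toℕ j)) ℤ.* a (toℕ j)

  termwise : ∀ j → + coefficient (suc (suc r)) (suc (k ∸ toℕ j)) ℤ.* a (toℕ j) ≡ low j ℤ.+ high j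
  termwise j = trans
    (cong (λ c → + c ℤ.* a (toℕ j)) (coefficient-pascal r (k ∸ toℕ j)))
    (ℤₚ.*-distribʳ-+ (a (toℕ j)) (+ coefficient (suc (suc r)) (k ∸ toℕ j))
      (+ coefficient (suc r) (suc (k ∸ toℕ j))))

-- Extension by zero and backward differences

extend : (ℕ → ℤ) → ℤ → ℤ
extend a (+ k)      = a k
extend a (-[1+ _ ]) = 0ℤ

extend-cong : ∀ {a b} → a ≗ b → extend a ≗ extend b
extend-cong a≗b (+ k)      = a≗b k
extend-cong a≗b (-[1+ _ ]) = refl

-- The bound is there because a row of `T` is a convolution of the previous row only below the
-- diagonal.
extend-cong-≤ : ∀ {a b n} → (∀ k → k ≤ n → a k ≡ b k) →
  ∀ z → z ℤ.≤ + n → extend a z ≡ extend b z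
extend-cong-≤ a≡b (+ k)      (ℤ.+≤+ k≤n) = a≡b k k≤n
extend-cong-≤ a≡b (-[1+ _ ]) _           = refl

-- Multiplication by 1 - x lowers the order by one. The zero at index -1 makes this hold at index 0
-- too, where both convolutions equal `a 0`.
convolution-difference : ∀ r a z →
  extend (convolution (suc r) a) z ℤ.- extend (convolution (suc r) a) (z ℤ.- 1ℤ) ≡
  extend (convolution r a) z
convolution-difference r a (+ zero)   = trans (ℤₚ.+-identityʳ _)
  (trans (convolution-origin (suc r) a) (sym (convolution-origin r a)))
convolution-difference r a (+ suc k)  = begin
  convolution (suc r) a (suc k) ℤ.- convolution (suc r) a k
    ≡⟨ cong (ℤ._- convolution (suc r) a k) (convolution-pascal r a k) ⟩
  convolution (suc r) a k ℤ.+ convolution r a (suc k) ℤ.- convolution (suc r) a k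
    ≡⟨ x+y-x≡y (convolution (suc r) a k) (convolution r a (suc k)) ⟩
  convolution r a (suc k)
    ∎
  where
  x+y-x≡y : ∀ x y → x ℤ.+ y ℤ.- x ≡ y
  x+y-x≡y = solve-∀
convolution-difference r a (-[1+ _ ]) = refl

-- Signed binomial sums as iterated backward differences

signedTerm : ℕ → (ℕ → ℤ) → ℕ → ℤ
signedTerm r g j = -1ℤ ℤ.^ j ℤ.* + (r C j) ℤ.* g j

-- The number `n` of terms is separate from the order `r`, since Pascal's rule produces a sum of
-- order `r` with `r + 2` terms, one more than the nonzero binomials.
signedSum : ℕ → ℕ → (ℕ → ℤ) → ℤ
signedSum r n g = ∑[ j < n ] signedTerm r g (toℕ j)

signedSum-cong : ∀ r n {f g} → f ≗ g → signedSum r n f ≡ signedSum r n g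
signedSum-cong r n f≗g =
  sum-cong-≗ {n} (λ j → cong (-1ℤ ℤ.^ toℕ j ℤ.* + (r C toℕ j) ℤ.*_) (f≗g (toℕ j)))

signedSum-excess : ∀ r g → signedSum r (suc (suc r)) g ≡ signedSum r (suc r) g
signedSum-excess r g = begin
  signedSum r (suc (suc r)) g
    ≡⟨ sum-init-last {suc r} (λ j → signedTerm r g (toℕ j)) ⟩
  (∑[ j ≤ r ] signedTerm r g (toℕ (inject₁ j))) ℤ.+ signedTerm r g (toℕ (fromℕ (suc r)))
    ≡⟨ cong₂ ℤ._+_ (sum-cong-≗ (λ j → cong (signedTerm r g) (toℕ-inject₁ {suc r} j))) lastTerm ⟩
  signedSum r (suc r) g ℤ.+ 0ℤ
    ≡⟨ ℤₚ.+-identityʳ _ ⟩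
  signedSum r (suc r) g
    ∎
  where
  lastTerm : signedTerm r g (toℕ (fromℕ (suc r))) ≡ 0ℤ
  lastTerm rewrite toℕ-fromℕ r | k>n⇒nCk≡0 (n<1+n r) | ℤₚ.*-zeroʳ (-1ℤ ℤ.^ suc r) = refl

signedSum-difference : ∀ r n g h →
  signedSum r n g ℤ.+ -1ℤ ℤ.* signedSum r n h ≡ signedSum r n (λ j → g j ℤ.- h j)
signedSum-difference r n g h = begin
  signedSum r n g ℤ.+ -1ℤ ℤ.* signedSum r n h
    ≡⟨ cong (λ x → signedSum r n g ℤ.+ x) (*-distribˡ-sum {n} -1ℤ (λ j → signedTerm r h (toℕ j))) ⟩
  signedSum r n g ℤ.+ (∑[ j < n ] (-1ℤ ℤ.* signedTerm r h (toℕ j)))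
    ≡⟨ ∑-distrib-+ {n} (λ j → signedTerm r g (toℕ j)) (λ j → -1ℤ ℤ.* signedTerm r h (toℕ j)) ⟨
  ∑[ j < n ] (signedTerm r g (toℕ j) ℤ.+ -1ℤ ℤ.* signedTerm r h (toℕ j))
    ≡⟨ sum-cong-≗ {n} (λ j → factor (-1ℤ ℤ.^ toℕ j ℤ.* + (r C toℕ j)) (g (toℕ j)) (h (toℕ j))) ⟩
  signedSum r n (λ j → g j ℤ.- h j)
    ∎
  where
  factor : ∀ c x y → c ℤ.* x ℤ.+ -1ℤ ℤ.* (c ℤ.* y) ≡ c ℤ.* (x ℤ.- y)
  factor = solve-∀

signedTerm-pascal : ∀ r g j →
  signedTerm (suc r) g (suc j) ≡ signedTerm r g (suc j) ℤ.+ -1ℤ ℤ.* signedTerm r (g ∘ suc) j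
signedTerm-pascal r g j = begin
  -1ℤ ℤ.* -1ℤ ℤ.^ j ℤ.* + (suc r C suc j) ℤ.* g (suc j)
    ≡⟨ cong (λ c → -1ℤ ℤ.* -1ℤ ℤ.^ j ℤ.* + c ℤ.* g (suc j)) (nCk+nC[k+1]≡[n+1]C[k+1] r j) ⟨
  -1ℤ ℤ.* -1ℤ ℤ.^ j ℤ.* (+ (r C j) ℤ.+ + (r C suc j)) ℤ.* g (suc j)
    ≡⟨ distribute (-1ℤ ℤ.^ j) (+ (r C j)) (+ (r C suc j)) (g (suc j)) ⟩
  signedTerm r g (suc j) ℤ.+ -1ℤ ℤ.* signedTerm r (g ∘ suc) j
    ∎
  where
  distribute : ∀ s x y z →
    -1ℤ ℤ.* s ℤ.* (x ℤ.+ y) ℤ.* z ≡ -1ℤ ℤ.* s ℤ.* y ℤ.* z ℤ.+ -1ℤ ℤ.* (s ℤ.* x ℤ.* z)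
  distribute = solve-∀

-- This is (1 - x)^(r+1) = (1 - x)^r (1 - x): Pascal's rule turns each term after the first into one
-- of order `r` minus its shift.
signedSum-pascal : ∀ r g →
  signedSum (suc r) (suc (suc r)) g ≡ signedSum r (suc r) (λ j → g j ℤ.- g (suc j))
signedSum-pascal r g = begin
  head ℤ.+ (∑[ j ≤ r ] signedTerm (suc r) g (suc (toℕ j)))
    ≡⟨ cong (λ x → head ℤ.+ x) (sum-cong-≗ {suc r} (λ j → signedTerm-pascal r g (toℕ j))) ⟩
  head ℤ.+ (∑[ j ≤ r ] (signedTerm r g (suc (toℕ j)) ℤ.+ -1ℤ ℤ.* signedTerm r (g ∘ suc) (toℕ j)))
    ≡⟨ cong (λ x → head ℤ.+ x) (∑-distrib-+ {suc r}
         (λ j → signedTerm r g (suc (toℕ j)))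
         (λ j → -1ℤ ℤ.* signedTerm r (g ∘ suc) (toℕ j))) ⟩
  head ℤ.+ (tail ℤ.+ (∑[ j ≤ r ] (-1ℤ ℤ.* signedTerm r (g ∘ suc) (toℕ j))))
    -- `head` is also the first term of the sum of order `r`, since both binomials with lower index
    -- 0 are 1.
    ≡⟨ ℤₚ.+-assoc head tail _ ⟨
  signedSum r (suc (suc r)) g ℤ.+ (∑[ j ≤ r ] (-1ℤ ℤ.* signedTerm r (g ∘ suc) (toℕ j)))
    ≡⟨ cong₂ ℤ._+_ (signedSum-excess r g) (sym (*-distribˡ-sum {suc r} -1ℤ (λ j → signedTerm r (g ∘ suc) (toℕ j)))) ⟩
  signedSum r (suc r) g ℤ.+ -1ℤ ℤ.* signedSum r (suc r) (g ∘ suc)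
    ≡⟨ signedSum-difference r (suc r) g (g ∘ suc) ⟩
  signedSum r (suc r) (λ j → g j ℤ.- g (suc j))
    ∎
  where
  head = signedTerm (suc r) g 0
  tail = ∑[ j ≤ r ] signedTerm r g (suc (toℕ j))

-- (1 - x)^r inverts (1 - x)^(-r). By induction, each backward difference uses up one order of the
-- convolution, and order 0 is the identity.
signedSum-convolution : ∀ r a z →
  signedSum r (suc r) (λ j → extend (convolution r a) (z ℤ.- + j)) ≡ extend a z
signedSum-convolution zero    a z = begin
  1ℤ ℤ.* extend (convolution 0 a) (z ℤ.- 0ℤ) ℤ.+ 0ℤ ≡⟨ ℤₚ.+-identityʳ _ ⟩
  1ℤ ℤ.* extend (convolution 0 a) (z ℤ.- 0ℤ)        ≡⟨ ℤₚ.*-identityˡ _ ⟩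
  extend (convolution 0 a) (z ℤ.- 0ℤ)               ≡⟨ cong (extend (convolution 0 a)) (ℤₚ.+-identityʳ z) ⟩
  extend (convolution 0 a) z                        ≡⟨ extend-cong (convolution-order0 a) z ⟩
  extend a z                                        ∎
signedSum-convolution (suc r) a z = begin
  signedSum (suc r) (suc (suc r)) (λ j → F (z ℤ.- + j))
    ≡⟨ signedSum-pascal r (λ j → F (z ℤ.- + j)) ⟩
  signedSum r (suc r) (λ j → F (z ℤ.- + j) ℤ.- F (z ℤ.- + suc j))
    ≡⟨ signedSum-cong r (suc r) lower ⟩
  signedSum r (suc r) (λ j → extend (convolution r a) (z ℤ.- + j))
    ≡⟨ signedSum-convolution r a z ⟩
  extend a z
    ∎
  where
  F = extend (convolution (suc r) a)

  shift : ∀ z x → z ℤ.- (1ℤ ℤ.+ x) ≡ z ℤ.- x ℤ.- 1ℤ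
  shift = solve-∀

  lower : ∀ j → F (z ℤ.- + j) ℤ.- F (z ℤ.- + suc j) ≡ extend (convolution r a) (z ℤ.- + j)
  lower j = trans (cong (λ w → F (z ℤ.- + j) ℤ.- F w) (shift z (+ j)))
                  (convolution-difference r a (z ℤ.- + j))

-- Existence of the extended array

extendedT : (p : ℕ) → .{{NonZero p}} → Array
extendedT p n = extend (T p n)

-- The signed sum over row `suc n` gives back row `n`; solving for its term at `j = 0` yields the
-- recurrence.
extendedT-recurrence : ∀ r n k → k < suc n →
  extendedT (suc r) (suc n) (+ k) ≡
    extendedT (suc r) n (+ k) ℤ.+
    (∑[ i < r ] (-1ℤ ℤ.^ toℕ i ℤ.* + (r C suc (toℕ i)) ℤ.*
                 extendedT (suc r) (suc n) (+ k ℤ.- + suc (toℕ i))))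
extendedT-recurrence r n k (s≤s k≤n) = begin
  U (+ k)
    ≡⟨ isolate (U (+ k)) rest ⟩
  (U (+ k) ℤ.+ -1ℤ ℤ.* rest) ℤ.+ rest
    ≡⟨ cong (ℤ._+ rest) difference ⟩
  T (suc r) n k ℤ.+ rest
    ∎
  where
  U = extendedT (suc r) (suc n)
  V = extend (convolution r (T (suc r) n))

  summand : Fin r → ℤ
  summand i = -1ℤ ℤ.^ toℕ i ℤ.* + (r C suc (toℕ i)) ℤ.* U (+ k ℤ.- + suc (toℕ i))

  rest = ∑[ i < r ] summand i

  isolate : ∀ x y → x ≡ (x ℤ.+ -1ℤ ℤ.* y) ℤ.+ y
  isolate = solve-∀

  flip : ∀ s c u → -1ℤ ℤ.* (s ℤ.* c ℤ.* u) ≡ -1ℤ ℤ.* s ℤ.* c ℤ.* u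
  flip = solve-∀

  -- Every column involved is at most `k ≤ n`, so the truncation at the diagonal is never met.
  U≡V : ∀ j → U (+ k ℤ.- + j) ≡ V (+ k ℤ.- + j)
  U≡V j = extend-cong-≤ (λ i i≤n → T-recurrence (suc r) n i (s≤s i≤n)) (+ k ℤ.- + j)
    (ℤₚ.≤-trans (ℤₚ.i-j≤i (+ k) (+ j)) (ℤ.+≤+ k≤n))

  difference : U (+ k) ℤ.+ -1ℤ ℤ.* rest ≡ T (suc r) n k
  difference = begin
    U (+ k) ℤ.+ -1ℤ ℤ.* rest
      -- `U (+ k)` becomes the term at 0, and the factor -1 turns the sign (-1)^(j-1) of the
      -- recurrence into (-1)^j.
      ≡⟨ cong₂ ℤ._+_
           (sym (trans (ℤₚ.*-identityˡ _) (cong U (ℤₚ.+-identityʳ (+ k)))))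
           (trans (*-distribˡ-sum -1ℤ summand)
                  (sum-cong-≗ {r} (λ i → flip (-1ℤ ℤ.^ toℕ i) (+ (r C suc (toℕ i)))
                                      (U (+ k ℤ.- + suc (toℕ i)))))) ⟩
    signedSum r (suc r) (λ j → U (+ k ℤ.- + j))
      ≡⟨ signedSum-cong r (suc r) U≡V ⟩
    signedSum r (suc r) (λ j → V (+ k ℤ.- + j))
      ≡⟨ signedSum-convolution r (T (suc r) n) (+ k) ⟩
    T (suc r) n k
      ∎

extendedT-isExtendedArray : ∀ r → IsExtendedArray (suc r) (extendedT (suc r))
extendedT-isExtendedArray r = record
  { origin     = refl
  ; diagonal   = λ { (suc n) _ → T-diagonal (suc r) n }
  ; negative   = λ { _ (suc _) _ _ → refl }
  ; recurrence = extendedT-recurrence r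
  }

-- Uniqueness of the extended array

module Uniqueness {r} {V W : Array}
  (isV : IsExtendedArray (suc r) V) (isW : IsExtendedArray (suc r) W) where

  private
    module V = IsExtendedArray isV
    module W = IsExtendedArray isW

  agree-negative : ∀ n j → 1 ≤ j → j ≤ r → V n (- + j) ≡ W n (- + j)
  agree-negative n j 1≤j j≤r = trans (V.negative n j 1≤j j≤r) (sym (W.negative n j 1≤j j≤r))

  -- Induction on the row, with strong induction on the column inside it, because the recurrence
  -- reaches back up to `r` columns in the same row.
  agree : ∀ n k → k ≤ n → V n (+ k) ≡ W n (+ k)
  agree zero    .zero z≤n = trans V.origin (sym W.origin)
  agree (suc n) = <-rec _ step
    where
    step : ∀ k → (∀ {i} → i < k → i ≤ suc n → V (suc n) (+ i) ≡ W (suc n) (+ i)) →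
      k ≤ suc n → V (suc n) (+ k) ≡ W (suc n) (+ k)
    step k rec k≤1+n with m≤n⇒m<n∨m≡n k≤1+n
    ... | inj₂ refl = trans (V.diagonal (suc n) z<s) (sym (W.diagonal (suc n) z<s))
    ... | inj₁ (s≤s k≤n) = begin
      V (suc n) (+ k)
        ≡⟨ V.recurrence n k (s≤s k≤n) ⟩
      V n (+ k) ℤ.+ _
        ≡⟨ cong₂ ℤ._+_ (agree n k k≤n)
             (sum-cong-≗ (λ i → cong (-1ℤ ℤ.^ toℕ i ℤ.* + (r C suc (toℕ i)) ℤ.*_)
                                     (earlier (suc (toℕ i)) z<s (toℕ<n i)))) ⟩
      W n (+ k) ℤ.+ _
        ≡⟨ W.recurrence n k (s≤s k≤n) ⟨
      W (suc n) (+ k)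
        ∎
      where
      earlier : ∀ j → 1 ≤ j → j ≤ r → V (suc n) (+ k ℤ.- + j) ≡ W (suc n) (+ k ℤ.- + j)
      -- Column `k - j` is either a smaller natural number, covered by induction, or `-(j - k)` with
      -- `1 ≤ j - k ≤ r`, where both arrays vanish.
      earlier j 1≤j j≤r with j ≤? k
      ... | yes j≤k rewrite ℤₚ.m-n≡m⊖n k j | ℤₚ.⊖-≥ j≤k =
        rec (∸-monoʳ-< 1≤j j≤k) (≤-trans (m∸n≤m k j) k≤1+n)
      ... | no  j≰k rewrite ℤₚ.m-n≡m⊖n k j | ℤₚ.⊖-< (≰⇒> j≰k) =
        agree-negative (suc n) (j ∸ k) (m<n⇒0<n∸m (≰⇒> j≰k)) (≤-trans (m∸n≤m j k) j≤r)

  unique : V ≈[ suc r ] W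
  unique n (+ k)    _   (ℤ.+≤+ k≤n) = agree n k k≤n
  unique n -[1+ j ] 1-p≤k _ = agree-negative n (suc j) z<s (bound r 1-p≤k)
    where
    bound : ∀ r → 1ℤ ℤ.- + suc r ℤ.≤ -[1+ j ] → suc j ≤ r
    -- For `r = 0` the lower bound is 0, so no negative column lies in the domain.
    bound (suc r) (ℤ.-≤- j≤r) = s≤s j≤r

proposition1 : (p : ℕ) → .{{_ : NonZero p}} →
    ∃[ U ] (IsExtendedArray p U
    × (∀ V → IsExtendedArray p V → V ≈[ p ] U)
    × (∀ n k → k ≤ n → U n (+ k) ≡ T p n k))
proposition1 (suc r) =
  extendedT (suc r) ,
  extendedT-isExtendedArray r ,
  (λ V isV → Uniqueness.unique isV (extendedT-isExtendedArray r)) ,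
  (λ n k k≤n → refl)
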